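{- Let $b\ge 2$ with $b\not\equiv 1\pmod 3$, and let $n\ge 2$. Then $$\mathrm{Ap}(T_{b'}(n),s'_0)=\Big\{\sum_{i=1}^{n+1} t_i s'_i : (t_1,\dots,t_{n+1})\in R_{b'}(n)\Big\}.$$
   Context: For integers $b\ge2$ with $b\not\equiv1\pmod3$, $n\ge0$, $i\ge0$ put $s'_i=(b+1)b^{n+i}+1$, and $T_{b'}(n)=\langle\{s'_i:i\in\mathbb{N}\}\rangle$ (submonoid of $(\mathbb{N},+)$ generated by them). For a numerical semigroup $S$ and $x\in S\setminus\{0\}$, $\mathrm{Ap}(S,x)=\{s\in S:s-x\notin S\}$. $R_{b'}(n)$ is the set of $(t_1,\dots,t_{n+1})\in\{0,1,\dots,b\}^{n+1}$ such that: (i) if $t_i=b$ then $t_j=0$ for all $1\le j<i$; (ii) $t_{n+1}\le b-1$; (iii) if $t_{n+1}=b-1$ then $t_n\le b-1$, and if $(t_n,t_{n+1})=(b-1,b-1)$ then $t_1\le 2$ and $t_i=0$ for all $i\notin\{1,n,n+1\}$. -}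

module Defs where

open import Level using (0ℓ)
open import Data.Nat using (ℕ; zero; suc; _+_; _*_; _∸_; _^_; _≤_)
open import Data.Nat.Properties using (+-0-monoid)
open import Data.Fin using (Fin; zero; suc; toℕ; fromℕ; inject₁; _<_)
open import Data.Vec.Functional using (Vector)
open import Data.Product using (∃-syntax; _×_)
open import Algebra.Properties.Monoid.Sum +-0-monoid using (sum)
open import Relation.Unary using (Pred; _∈_)
open import Relation.Binary.PropositionalEquality using (_≡_; _≢_)

data ⟨_⟩ (G : Pred ℕ 0ℓ) : Pred ℕ 0ℓ where
  gen  : ∀ {x} → x ∈ G → x ∈ ⟨ G ⟩
  zero : 0 ∈ ⟨ G ⟩
  add  : ∀ {x y} → x ∈ ⟨ G ⟩ → y ∈ ⟨ G ⟩ → x + y ∈ ⟨ G ⟩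

-- The difference s - x is taken in ℤ, so s - x ∉ S says that no u ∈ S
-- satisfies u + x = s (truncated subtraction would be wrong when s < x).
Ap : Pred ℕ 0ℓ → ℕ → Pred ℕ 0ℓ
Ap S x s = s ∈ S × (∀ u → u ∈ S → u + x ≢ s)

s′ : (b n i : ℕ) → ℕ
s′ b n i = suc b * b ^ (n + i) + 1

T′ : (b n : ℕ) → Pred ℕ 0ℓ
T′ b n = ⟨ (λ x → ∃[ i ] x ≡ s′ b n i) ⟩

-- A tuple (t₁, …, tₙ₊₁) is a Vector ℕ (suc n); tᵢ is the entry at the
-- Fin (suc n) position whose toℕ is i - 1.

pos₁ : ∀ n → Fin (suc n)
pos₁ n = zero

-- For n = 0 there is no entry tₙ and the value is arbitrary.
posₙ : ∀ n → Fin (suc n)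
posₙ zero    = zero
posₙ (suc m) = inject₁ (fromℕ m)

posₙ₊₁ : ∀ n → Fin (suc n)
posₙ₊₁ n = fromℕ n

record R′ (b n : ℕ) (t : Vector ℕ (suc n)) : Set where
  field
    entries≤b : ∀ i → t i ≤ b
    cond-i    : ∀ i → t i ≡ b → ∀ j → j < i → t j ≡ 0
    cond-ii   : t (posₙ₊₁ n) ≤ b ∸ 1
    cond-iii₁ : t (posₙ₊₁ n) ≡ b ∸ 1 → t (posₙ n) ≤ b ∸ 1
    cond-iii₂ : t (posₙ n) ≡ b ∸ 1 → t (posₙ₊₁ n) ≡ b ∸ 1 →
                t (pos₁ n) ≤ 2 ×
                (∀ i → i ≢ pos₁ n → i ≢ posₙ n → i ≢ posₙ₊₁ n → t i ≡ 0)

combination : (b n : ℕ) → Vector ℕ (suc n) → ℕ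
combination b n t = sum (λ i → t i * s′ b n (suc (toℕ i)))

R′-sums : (b n : ℕ) → Pred ℕ 0ℓ
R′-sums b n x = ∃[ t ] (t ∈ R′ b n × x ≡ combination b n t)

{-# OPTIONS --safe #-}

-- Write b = c + 1, S = s′₀ and let [i] be the base-b repunit with i ones. Then
-- s′ᵢ = S + (S - 1) c [i], so a sum of D generators of total repunit weight Q
-- equals S D + (S - 1) c Q. As S ≡ 3 (mod c) and 3 ∤ c, the factor (S - 1) c is
-- invertible modulo S, and the residue of the sum determines Q mod S. For
-- fixed Q the sum is least when D is, and the greedy partition of Q into
-- repunits minimises D. Finally, condition (i) describes the greedy digit
-- strings, and the largest element of R′, (2, 0, …, 0, b - 1, b - 1), has weight
-- exactly S - 1, so (ii) and (iii) say that the weight is less than S.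

module Submission where

open import Defs
open import Data.Fin using (Fin; zero; suc; toℕ; fromℕ; fromℕ<)
open import Data.Fin.Properties using (toℕ-fromℕ; toℕ-fromℕ<; toℕ-inject₁; toℕ-injective; toℕ<n)
open import Data.Nat using (ℕ; zero; suc; _+_; _*_; _^_; _≤_; _<_; _≤?_; _≤′_; ≤′-refl; ≤′-step; z≤n; s≤s; s≤s⁻¹; NonZero)
open import Data.Nat.Coprimality using (Coprime; coprime-divisor)
open import Data.Nat.Divisibility using (_∣_; divides; ∣m+n∣m⇒∣n; >⇒∤; ∣m⇒∣m*n; m∣m*n; n∣m*n; 0∣⇒≡0)
open import Data.Nat.DivMod using (_%_; _/_; m≡m%n+[m/n]*n; [m+kn]%n≡m%n; m%n<n; m<n⇒m%n≡m; m<n⇒m/n≡0; +-distrib-/-∣ʳ; m*n/n≡m)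
open import Data.Nat.Properties
open import Algebra.Properties.Monoid.Sum +-0-monoid using (sum; sum-cong-≗)
open import Data.Nat.Tactic.RingSolver using (solve-∀)
open import Data.Product using (∃-syntax; _×_; _,_; proj₁; proj₂)
open import Data.Sum using (inj₁; inj₂)
open import Data.Vec.Functional using (Vector)
open import Relation.Binary.PropositionalEquality using (_≡_; _≢_; refl; sym; trans; cong; cong₂; subst; subst₂; module ≡-Reasoning)
open import Relation.Nullary using (yes; no; contradiction)
open import Relation.Unary using (_≐_)

-- Sums over an initial segment of ℕ.

Σ≤ : ℕ → (ℕ → ℕ) → ℕ
Σ≤ zero    f = f 0
Σ≤ (suc k) f = Σ≤ k f + f (suc k)

Σ≤-cong : ∀ k {f g} → (∀ i → i ≤ k → f i ≡ g i) → Σ≤ k f ≡ Σ≤ k g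
Σ≤-cong zero    f≗g = f≗g 0 z≤n
Σ≤-cong (suc k) f≗g = cong₂ _+_ (Σ≤-cong k λ i i≤k → f≗g i (m≤n⇒m≤1+n i≤k)) (f≗g (suc k) ≤-refl)

Σ≤-suc : ∀ k f → Σ≤ (suc k) f ≡ f 0 + Σ≤ k (λ i → f (suc i))
Σ≤-suc zero    f = refl
Σ≤-suc (suc k) f = trans (cong (_+ f (suc (suc k))) (Σ≤-suc k f)) (+-assoc (f 0) _ _)

term≤Σ≤ : ∀ k f i → i ≤ k → f i ≤ Σ≤ k f
term≤Σ≤ zero    f zero z≤n = ≤-refl
term≤Σ≤ (suc k) f i i≤1+k with i ≤? k
... | yes i≤k = ≤-trans (term≤Σ≤ k f i i≤k) (m≤m+n _ _)
... | no  i≰k rewrite ≤-antisym i≤1+k (≰⇒> i≰k) = m≤n+m _ _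

Σ≤-head : ∀ k f → (∀ i → suc i ≤ k → f (suc i) ≡ 0) → Σ≤ k f ≡ f 0
Σ≤-head zero    f f≡0 = refl
Σ≤-head (suc k) f f≡0 =
  trans (cong₂ _+_ (Σ≤-head k f λ i i<k → f≡0 i (m≤n⇒m≤1+n i<k)) (f≡0 k ≤-refl)) (+-identityʳ (f 0))

Σ≤-zero : ∀ k f → (∀ i → i ≤ k → f i ≡ 0) → Σ≤ k f ≡ 0
Σ≤-zero k f f≡0 = trans (Σ≤-head k f λ i → f≡0 (suc i)) (f≡0 0 z≤n)

Σ≤-linear : ∀ k x y f g → Σ≤ k (λ i → x * f i + y * g i) ≡ x * Σ≤ k f + y * Σ≤ k g
Σ≤-linear zero    x y f g = refl
Σ≤-linear (suc k) x y f g = trans (cong (_+ (x * f (suc k) + y * g (suc k))) (Σ≤-linear k x y f g)) (lemma x y _ _ _ _)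
  where
  lemma : ∀ x y F G u v → x * F + y * G + (x * u + y * v) ≡ x * (F + u) + y * (G + v)
  lemma = solve-∀

-- Repunits and the length of greedy partitions.

module Repunit (c : ℕ) where

  b : ℕ
  b = suc c

  -- rep k is the base-b repunit with k + 1 ones.
  rep : ℕ → ℕ
  rep zero    = 1
  rep (suc k) = suc (b * rep k)

  rep-NonZero : ∀ k → NonZero (rep k)
  rep-NonZero zero    = _
  rep-NonZero (suc k) = _

  ^-rep : ∀ k → b ^ suc k ≡ suc (c * rep k)
  ^-rep zero    = refl
  ^-rep (suc k) = trans (cong (b *_) (^-rep k)) (lemma c (rep k))
    where
    lemma : ∀ c r → suc c * suc (c * r) ≡ suc (c * suc (suc c * r))
    lemma = solve-∀

  -- The number of parts in the greedy partition of q into rep 0, …, rep k.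
  cost : ℕ → ℕ → ℕ
  cost zero    q = q
  cost (suc k) q = q / rep (suc k) + cost k (q % rep (suc k))

  cost-shift : ∀ k q e → cost k (q + e * rep k) ≡ e + cost k q
  cost-shift zero    q e = trans (cong (q +_) (*-identityʳ e)) (+-comm q e)
  cost-shift (suc k) q e = begin
    (q + e * N) / N + cost k ((q + e * N) % N)  ≡⟨ cong₂ _+_ (+-distrib-/-∣ʳ q (n∣m*n e)) (cong (cost k) ([m+kn]%n≡m%n q e N)) ⟩
    q / N + e * N / N + cost k (q % N)          ≡⟨ cong (λ x → q / N + x + cost k (q % N)) (m*n/n≡m e N) ⟩
    q / N + e + cost k (q % N)                  ≡⟨ cong (_+ cost k (q % N)) (+-comm (q / N) e) ⟩
    e + q / N + cost k (q % N)                  ≡⟨ +-assoc e _ _ ⟩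
    e + (q / N + cost k (q % N))                ∎
    where
    open ≡-Reasoning
    N = rep (suc k)

  cost-small : ∀ k {q} → q < rep (suc k) → cost (suc k) q ≡ cost k q
  cost-small k q<N = cong₂ _+_ (m<n⇒m/n≡0 q<N) (cong (cost k) (m<n⇒m%n≡m q<N))

  cost-0 : ∀ k → cost k 0 ≡ 0
  cost-0 zero    = refl
  cost-0 (suc k) = trans (cost-small k (s≤s z≤n)) (cost-0 k)

  -- Divide `suc q` by `rep (suc k)`. If the remainder is positive, the unit comes off it and
  -- induction applies. If it is zero, one `rep (suc k)` minus the unit becomes `b` copies of
  -- `rep k`, a net gain of `c` parts.
  cost-pred : ∀ k q → cost k q ≤ c + cost k (suc q)
  cost-pred zero    q = ≤-trans (n≤1+n q) (m≤n+m (suc q) c)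
  cost-pred (suc k) q = go (suc q % N) (suc q / N) (m%n<n (suc q) N) (m≡m%n+[m/n]*n (suc q) N)
    where
    open ≤-Reasoning
    N = rep (suc k)
    go : ∀ r e → r < N → suc q ≡ r + e * N → cost (suc k) q ≤ c + cost (suc k) (suc q)
    go zero (suc e) _ eq = begin
      cost (suc k) q                       ≡⟨ cong (cost (suc k)) (suc-injective eq) ⟩
      cost (suc k) (b * rep k + e * N)     ≡⟨ cost-shift (suc k) (b * rep k) e ⟩
      -- `rep (suc k)` unfolds to `suc (b * rep k)`, so `≤-refl` is the required strict bound.
      e + cost (suc k) (b * rep k)         ≡⟨ cong (e +_) (cost-small k ≤-refl) ⟩
      e + cost k (0 + b * rep k)           ≡⟨ cong (e +_) (cost-shift k 0 b) ⟩
      e + (b + cost k 0)                   ≡⟨ cong (λ x → e + (b + x)) (trans (cost-0 k) (sym (cost-0 (suc k)))) ⟩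
      e + (b + cost (suc k) 0)             ≡⟨ lemma c e _ ⟩
      c + (suc e + cost (suc k) 0)         ≡⟨ cong (c +_) (cost-shift (suc k) 0 (suc e)) ⟨
      c + cost (suc k) (suc e * N)         ≡⟨ cong (λ x → c + cost (suc k) x) eq ⟨
      c + cost (suc k) (suc q)             ∎
      where
      lemma : ∀ c e x → e + (suc c + x) ≡ c + (suc e + x)
      lemma = solve-∀
    go (suc r) e r<N eq = begin
      cost (suc k) q                       ≡⟨ cong (cost (suc k)) (suc-injective eq) ⟩
      cost (suc k) (r + e * N)             ≡⟨ cost-shift (suc k) r e ⟩
      e + cost (suc k) r                   ≡⟨ cong (e +_) (cost-small k (<⇒≤ r<N)) ⟩
      e + cost k r                         ≤⟨ +-monoʳ-≤ e (cost-pred k r) ⟩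
      e + (c + cost k (suc r))             ≡⟨ cong (λ x → e + (c + x)) (cost-small k r<N) ⟨
      e + (c + cost (suc k) (suc r))       ≡⟨ lemma c e _ ⟩
      c + (e + cost (suc k) (suc r))       ≡⟨ cong (c +_) (cost-shift (suc k) (suc r) e) ⟨
      c + cost (suc k) (suc r + e * N)     ≡⟨ cong (λ x → c + cost (suc k) x) eq ⟨
      c + cost (suc k) (suc q)             ∎
      where
      lemma : ∀ c e x → e + (c + x) ≡ c + (e + x)
      lemma = solve-∀

  -- Exchanging b copies of rep k and a unit for one rep (k + 1) does not
  -- increase the number of parts: removing the unit costs at most c = b - 1.
  cost-rep-suc : ∀ k q → suc (cost k q) ≤ cost k (q + rep (suc k))
  cost-rep-suc k q = begin
    suc (cost k q)                ≤⟨ s≤s (cost-pred k q) ⟩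
    b + cost k (suc q)            ≡⟨ cost-shift k (suc q) b ⟨
    cost k (suc q + b * rep k)    ≡⟨ cong (cost k) (+-suc q (b * rep k)) ⟨
    cost k (q + rep (suc k))      ∎
    where open ≤-Reasoning

  -- Adding one copy of `rep (suc k)` raises `cost k` by at least 1 (`cost-rep-suc`), and the
  -- quotient counts these copies.
  cost-suc : ∀ k q → cost (suc k) q ≤ cost k q
  cost-suc k q = subst (λ x → cost (suc k) q ≤ cost k x) (sym (m≡m%n+[m/n]*n q N)) (go (q / N))
    where
    open ≤-Reasoning
    N = rep (suc k)
    r = q % N
    go : ∀ e → e + cost k r ≤ cost k (r + e * N)
    go zero    = ≤-reflexive (cong (cost k) (sym (+-identityʳ r)))
    go (suc e) = begin
      suc (e + cost k r)          ≤⟨ s≤s (go e) ⟩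
      suc (cost k (r + e * N))    ≤⟨ cost-rep-suc k (r + e * N) ⟩
      cost k (r + e * N + N)      ≡⟨ cong (cost k) (trans (+-assoc r (e * N) N) (cong (r +_) (+-comm (e * N) N))) ⟩
      cost k (r + suc e * N)      ∎

  cost≤ : ∀ k q → cost k q ≤ q
  cost≤ zero    q = ≤-refl
  cost≤ (suc k) q = ≤-trans (cost-suc k q) (cost≤ k q)

  -- With `cost-rep`, this is the optimality of the greedy partition: a sum of D parts from `rep 0`,
  -- ..., `rep k` has cost at most D.
  cost-+ : ∀ k p q → cost k (p + q) ≤ cost k p + cost k q
  cost-+ zero    p q = ≤-refl
  cost-+ (suc k) p q = begin
    cost (suc k) (p + q)                                      ≡⟨ cong (cost (suc k)) split ⟩
    cost (suc k) (p % N + q % N + (p / N + q / N) * N)        ≡⟨ cost-shift (suc k) (p % N + q % N) (p / N + q / N) ⟩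
    p / N + q / N + cost (suc k) (p % N + q % N)              ≤⟨ +-monoʳ-≤ (p / N + q / N) (cost-suc k _) ⟩
    p / N + q / N + cost k (p % N + q % N)                    ≤⟨ +-monoʳ-≤ (p / N + q / N) (cost-+ k (p % N) (q % N)) ⟩
    p / N + q / N + (cost k (p % N) + cost k (q % N))         ≡⟨ interchange (p / N) (q / N) _ _ ⟩
    p / N + cost k (p % N) + (q / N + cost k (q % N))         ∎
    where
    open ≤-Reasoning
    N = rep (suc k)
    interchange : ∀ x y z w → x + y + (z + w) ≡ x + z + (y + w)
    interchange = solve-∀
    regroup : ∀ r s e f N → (r + e * N) + (s + f * N) ≡ r + s + (e + f) * N
    regroup = solve-∀
    split : p + q ≡ p % N + q % N + (p / N + q / N) * N
    split = trans (cong₂ _+_ (m≡m%n+[m/n]*n p N) (m≡m%n+[m/n]*n q N)) (regroup (p % N) (q % N) (p / N) (q / N) N)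

  cost-rep : ∀ k i → i ≤ k → cost k (rep i) ≤ 1
  cost-rep k i i≤k = go (≤⇒≤′ i≤k)
    where
    go : ∀ {k} → i ≤′ k → cost k (rep i) ≤ 1
    go ≤′-refl           = ≤-reflexive (trans (cong (cost i) (sym (*-identityˡ (rep i)))) (trans (cost-shift i 0 1) (cong suc (cost-0 i))))
    go (≤′-step {k} i≤k) = ≤-trans (cost-suc k (rep i)) (go i≤k)

  -- Greedy digit strings and condition (i).

  -- The tuple (t₁, …, tₖ₊₁) is the digit function f with f i = tᵢ₊₁.
  value : ℕ → (ℕ → ℕ) → ℕ
  value k f = Σ≤ k (λ i → f i * rep i)

  -- At every level the lower digits form an admissible remainder, so dividing by the repunits from
  -- the top down recovers `f`.
  Greedy : ℕ → (ℕ → ℕ) → Set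
  Greedy k f = ∀ j → j ≤ k → value j f < rep (suc j)

  Greedy-pred : ∀ {k f} → Greedy (suc k) f → Greedy k f
  Greedy-pred g j j≤k = g j (m≤n⇒m≤1+n j≤k)

  cost-value : ∀ k f → Greedy k f → cost k (value k f) ≡ Σ≤ k f
  cost-value zero    f g = *-identityʳ (f 0)
  cost-value (suc k) f g = begin
    cost (suc k) (value k f + f (suc k) * rep (suc k))  ≡⟨ cost-shift (suc k) (value k f) (f (suc k)) ⟩
    f (suc k) + cost (suc k) (value k f)                ≡⟨ cong (f (suc k) +_) (cost-small k (g k (n≤1+n k))) ⟩
    f (suc k) + cost k (value k f)                      ≡⟨ cong (f (suc k) +_) (cost-value k f (Greedy-pred {f = f} g)) ⟩
    f (suc k) + Σ≤ k f                                  ≡⟨ +-comm (f (suc k)) _ ⟩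
    Σ≤ k f + f (suc k)                                  ∎
    where open ≡-Reasoning

  _[_≔_] : (ℕ → ℕ) → ℕ → ℕ → (ℕ → ℕ)
  (f [ k ≔ v ]) i with i ≤? k
  ... | yes _ = f i
  ... | no  _ = v

  extend-≤ : ∀ f k v i → i ≤ k → (f [ k ≔ v ]) i ≡ f i
  extend-≤ f k v i i≤k with i ≤? k
  ... | yes _   = refl
  ... | no  i≰k = contradiction i≤k i≰k

  extend-suc : ∀ f k v → (f [ k ≔ v ]) (suc k) ≡ v
  extend-suc f k v with suc k ≤? k
  ... | yes k<k = contradiction k<k (<-irrefl refl)
  ... | no  _   = refl

  value-extend : ∀ f k v j → j ≤ k → value j (f [ k ≔ v ]) ≡ value j f
  value-extend f k v j j≤k = Σ≤-cong j λ i i≤j → cong (_* rep i) (extend-≤ f k v i (≤-trans i≤j j≤k))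

  greedy-digits : ∀ k q → q < rep (suc k) → ∃[ f ] (Greedy k f × value k f ≡ q)
  greedy-digits zero    q q<N = (λ _ → q) , (λ { zero _ → subst (_< rep 1) (sym (*-identityʳ q)) q<N }) , *-identityʳ q
  greedy-digits (suc k) q q<N with greedy-digits k (q % rep (suc k)) (m%n<n q (rep (suc k)))
  ... | f , g , eq = f′ , g′ , eq′
    where
    N = rep (suc k)
    f′ = f [ k ≔ q / N ]
    eq′ : value (suc k) f′ ≡ q
    eq′ = trans (cong₂ _+_ (trans (value-extend f k (q / N) k ≤-refl) eq) (cong (_* N) (extend-suc f k (q / N))))
                (sym (m≡m%n+[m/n]*n q N))
    g′ : Greedy (suc k) f′
    g′ j j≤1+k with j ≤? k
    ... | yes j≤k = subst (_< rep (suc j)) (sym (value-extend f k (q / N) j j≤k)) (g j j≤k)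
    ... | no  j≰k with ≤-antisym j≤1+k (≰⇒> j≰k)
    ... | refl = subst (_< rep (suc j)) (sym eq′) q<N

  rep>0 : ∀ k → 1 ≤ rep k
  rep>0 zero    = s≤s z≤n
  rep>0 (suc k) = s≤s z≤n

  -- By induction on the place: a digit below `b` leaves room for one more copy of its repunit,
  -- which exceeds the value of the lower digits; a digit `b` has only zeros below and gives exactly
  -- one less than the next repunit.
  digits⇒Greedy : ∀ k f → (∀ i → i ≤ k → f i ≤ b) → (∀ i → i ≤ k → f i ≡ b → ∀ j → j < i → f j ≡ 0) → Greedy k f
  digits⇒Greedy k f ≤b lower zero    j≤k = s≤s (*-monoˡ-≤ 1 (≤b 0 j≤k))
  digits⇒Greedy k f ≤b lower (suc j) j≤k with m≤n⇒m<n∨m≡n (≤b (suc j) j≤k)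
  ... | inj₁ f<b = m≤n⇒m≤1+n (begin
    suc (value j f) + f (suc j) * N  ≤⟨ +-monoˡ-≤ _ (digits⇒Greedy k f ≤b lower j (<⇒≤ j≤k)) ⟩
    suc (f (suc j)) * N              ≤⟨ *-monoˡ-≤ N f<b ⟩
    b * N                            ∎)
    where
    open ≤-Reasoning
    N = rep (suc j)
  ... | inj₂ f≡b = s≤s (≤-reflexive (cong₂ (λ x y → x + y * rep (suc j)) value≡0 f≡b))
    where
    value≡0 : value j f ≡ 0
    value≡0 = Σ≤-zero j _ λ i i≤j → cong (_* rep i) (lower (suc j) j≤k f≡b i (s≤s i≤j))

  Greedy⇒≤b : ∀ {k} f → Greedy k f → ∀ i → i ≤ k → f i ≤ b
  Greedy⇒≤b f g i i≤k = *-cancelʳ-≤ (f i) b (rep i) ⦃ rep-NonZero i ⦄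
    (≤-trans (term≤Σ≤ i (λ i → f i * rep i) i ≤-refl) (s≤s⁻¹ (g i i≤k)))

  -- A digit `b` alone attains the largest value that greediness allows up to its place, so nothing
  -- is left for the lower digits.
  Greedy⇒lower : ∀ {k} f → Greedy k f → ∀ i → i ≤ k → f i ≡ b → ∀ j → j < i → f j ≡ 0
  Greedy⇒lower f g (suc i) i≤k f≡b j (s≤s j≤i) =
    m*n≡0⇒m≡0 (f j) (rep j) ⦃ rep-NonZero j ⦄
      (n≤0⇒n≡0 (≤-trans (term≤Σ≤ i (λ i → f i * rep i) j j≤i) value≤0))
    where
    N = rep (suc i)
    value≤0 : value i f ≤ 0
    value≤0 = +-cancelʳ-≤ (b * N) (value i f) 0
      (subst (λ x → value i f + x * N ≤ b * N) f≡b (s≤s⁻¹ (g (suc i) i≤k)))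

  -- Weights below the multiplicity and conditions (ii), (iii).

  -- The multiplicity s′₀ for n = k + 1.
  mult : ℕ → ℕ
  mult k = 3 + (c * rep k + c * rep (suc k))

  module _ (c≥1 : 1 ≤ c) where

    3≤rep : ∀ k → 3 ≤ rep (suc k)
    3≤rep k = s≤s (*-mono-≤ (s≤s c≥1) (rep>0 k))

    -- With `n = k + 2` this puts all residues below `rep (suc n)`, so `n + 1` greedy digits
    -- represent them, and it forces the top digit below `b`.
    mult≤ : ∀ k → mult (suc k) ≤ b * rep (suc (suc k))
    mult≤ k = begin
      3 + (c * r + c * r′)      ≤⟨ +-monoˡ-≤ _ (m≤n⇒m≤1+n (3≤rep k)) ⟩
      suc r + (c * r + c * r′)  ≡⟨ +-assoc (suc r) (c * r) (c * r′) ⟨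
      r′ + c * r′               ∎
      where
      open ≤-Reasoning
      r  = rep (suc k)
      r′ = rep (suc (suc k))

    module _ (l : ℕ) (f : ℕ → ℕ) where

      private
        n r r′ : ℕ
        n  = suc (suc l)
        r  = rep (suc l)
        r′ = rep n
        open ≤-Reasoning

      -- Compare with `3 + (c * r + c * r′)` from the top. The first of the two leading digits below
      -- `c` leaves a whole repunit free, more than the lower digits can fill by greediness; if both
      -- are `c`, the rest is at most 2.
      value<mult : Greedy n f → f n ≤ c → (f n ≡ c → f (suc l) ≤ c) →
        (f (suc l) ≡ c → f n ≡ c → f 0 ≤ 2 × (∀ i → suc i ≤ l → f (suc i) ≡ 0)) →
        value n f < mult (suc l)
      value<mult g u≤c v≤c tail with m≤n⇒m<n∨m≡n u≤c
      ... | inj₁ u<c = begin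
        suc (value (suc l) f) + f n * r′  ≤⟨ +-monoˡ-≤ _ (g (suc l) (n≤1+n _)) ⟩
        suc (f n) * r′                    ≤⟨ *-monoˡ-≤ r′ u<c ⟩
        c * r′                            ≤⟨ m≤n+m _ (3 + c * r) ⟩
        mult (suc l)                      ∎
      ... | inj₂ u≡c with m≤n⇒m<n∨m≡n (v≤c u≡c)
      ... | inj₁ v<c = begin
        suc (value l f) + f (suc l) * r + f n * r′  ≤⟨ +-monoˡ-≤ _ (+-monoˡ-≤ _ (g l (m≤n⇒m≤1+n (n≤1+n l)))) ⟩
        suc (f (suc l)) * r + f n * r′              ≤⟨ +-mono-≤ (*-monoˡ-≤ r v<c) (*-monoˡ-≤ r′ u≤c) ⟩
        c * r + c * r′                              ≤⟨ m≤n+m _ 3 ⟩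
        mult (suc l)                                ∎
      ... | inj₂ v≡c = begin
        suc (value l f) + f (suc l) * r + f n * r′  ≤⟨ +-mono-≤ (+-mono-≤ (s≤s value≤2) (*-monoˡ-≤ r (≤-reflexive v≡c))) (*-monoˡ-≤ r′ u≤c) ⟩
        3 + c * r + c * r′                          ≡⟨ +-assoc 3 (c * r) (c * r′) ⟩
        mult (suc l)                                ∎
        where
        value≤2 : value l f ≤ 2
        value≤2 = begin
          value l f  ≡⟨ Σ≤-head l _ (λ i i<l → cong (_* rep (suc i)) (proj₂ (tail v≡c u≡c) i i<l)) ⟩
          f 0 * 1    ≡⟨ *-identityʳ (f 0) ⟩
          f 0        ≤⟨ proj₁ (tail v≡c u≡c) ⟩
          2          ∎

      top≤c : value n f < mult (suc l) → f n ≤ c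
      top≤c v<m = ≮⇒≥ λ c<u → <-irrefl refl (begin-strict
        b * r′        ≤⟨ *-monoˡ-≤ r′ c<u ⟩
        f n * r′      ≤⟨ m≤n+m _ _ ⟩
        value n f     <⟨ v<m ⟩
        mult (suc l)  ≤⟨ mult≤ l ⟩
        b * r′        ∎)

      -- A digit `b` here, next to a top digit `c`, would exceed `c * r + c * r′` by `r`, and `r` is
      -- at least 3.
      second≤c : value n f < mult (suc l) → f n ≡ c → f (suc l) ≤ c
      second≤c v<m u≡c = ≮⇒≥ λ c<v → <-irrefl refl (begin-strict
        b * r + c * r′            ≤⟨ +-mono-≤ (*-monoˡ-≤ r c<v) (*-monoˡ-≤ r′ (≤-reflexive (sym u≡c))) ⟩
        f (suc l) * r + f n * r′  ≤⟨ +-monoˡ-≤ (f n * r′) (m≤n+m (f (suc l) * r) (value l f)) ⟩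
        value n f                 <⟨ v<m ⟩
        3 + (c * r + c * r′)      ≤⟨ +-monoˡ-≤ _ (3≤rep l) ⟩
        r + (c * r + c * r′)      ≡⟨ +-assoc r (c * r) (c * r′) ⟨
        b * r + c * r′            ∎)

      module _ (v<m : value n f < mult (suc l)) (v≡c : f (suc l) ≡ c) (u≡c : f n ≡ c) where

        value<3 : value l f < 3
        value<3 = +-cancelʳ-< (c * r + c * r′) (value l f) 3 (begin-strict
          value l f + (c * r + c * r′)          ≡⟨ +-assoc (value l f) (c * r) (c * r′) ⟨
          value l f + c * r + c * r′            ≡⟨ cong₂ (λ x y → value l f + x * r + y * r′) v≡c u≡c ⟨
          value n f                             <⟨ v<m ⟩
          mult (suc l)                          ∎)

        first≤2 : f 0 ≤ 2
        first≤2 = begin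
          f 0        ≡⟨ *-identityʳ (f 0) ⟨
          f 0 * 1    ≤⟨ term≤Σ≤ l (λ i → f i * rep i) 0 z≤n ⟩
          value l f  ≤⟨ s≤s⁻¹ value<3 ⟩
          2          ∎

        -- Repunits after the first are at least 3, but less than 3 remains below the two leading
        -- digits.
        middle≡0 : ∀ i → suc i ≤ l → f (suc i) ≡ 0
        middle≡0 i i<l = n≤0⇒n≡0 (≮⇒≥ λ 0<f → <-irrefl refl (begin-strict
          3                        ≤⟨ *-mono-≤ 0<f (3≤rep i) ⟩
          f (suc i) * rep (suc i)  ≤⟨ term≤Σ≤ l (λ i → f i * rep i) (suc i) i<l ⟩
          value l f                <⟨ value<3 ⟩
          3                        ∎))

  -- Generators in terms of repunits.

  -- M n = s′₀ - 1.
  M : ℕ → ℕ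
  M n = suc b * b ^ n

  -- Since (b + 1) b^n = b^n + b^(n + 1), `^-rep` contributes a 1 from each power; with the final 1
  -- of s′₀ they make the 3, which is the source of the bound 2 in condition (iii).
  suc-M : ∀ k → suc (M (suc k)) ≡ mult k
  suc-M k = trans (cong (λ x → suc (suc b * x)) (^-rep k)) (lemma c (rep k))
    where
    lemma : ∀ c r → suc (suc (suc c) * suc (c * r)) ≡ 3 + (c * r + c * suc (suc c * r))
    lemma = solve-∀

  s′-zero : ∀ n → s′ b n 0 ≡ suc (M n)
  s′-zero n = trans (+-comm (suc b * b ^ (n + 0)) 1) (cong (λ x → suc (M x)) (+-identityʳ n))

  s′-suc : ∀ n i → s′ b n (suc i) ≡ suc (M n) + M n * c * rep i
  s′-suc n i = begin
    suc b * b ^ (n + suc i) + 1            ≡⟨ cong (λ x → suc b * x + 1) (^-distribˡ-+-* b n (suc i)) ⟩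
    suc b * (b ^ n * b ^ suc i) + 1        ≡⟨ cong (λ x → suc b * (b ^ n * x) + 1) (^-rep i) ⟩
    suc b * (b ^ n * suc (c * rep i)) + 1  ≡⟨ lemma (suc b) (b ^ n) c (rep i) ⟩
    suc (M n) + M n * c * rep i            ∎
    where
    open ≡-Reasoning
    lemma : ∀ x y c r → x * (y * suc (c * r)) + 1 ≡ suc (x * y) + x * y * c * r
    lemma = solve-∀

  sum-toℕ : ∀ n (g : ℕ → ℕ) → sum {suc n} (λ i → g (toℕ i)) ≡ Σ≤ n g
  sum-toℕ zero    g = +-identityʳ (g 0)
  sum-toℕ (suc n) g = trans (cong (g 0 +_) (sum-toℕ n (λ i → g (suc i)))) (sym (Σ≤-suc n g))

  combination-toℕ : ∀ n f → combination b n (λ i → f (toℕ i)) ≡ suc (M n) * Σ≤ n f + M n * c * value n f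
  combination-toℕ n f = begin
    combination b n (λ i → f (toℕ i))                                  ≡⟨ sum-toℕ n (λ i → f i * s′ b n (suc i)) ⟩
    Σ≤ n (λ i → f i * s′ b n (suc i))                                  ≡⟨ Σ≤-cong n (λ i _ → trans (cong (f i *_) (s′-suc n i)) (lemma (f i) (suc (M n)) (M n * c) (rep i))) ⟩
    Σ≤ n (λ i → suc (M n) * f i + M n * c * (f i * rep i))             ≡⟨ Σ≤-linear n (suc (M n)) (M n * c) f (λ i → f i * rep i) ⟩
    suc (M n) * Σ≤ n f + M n * c * value n f                           ∎
    where
    open ≡-Reasoning
    lemma : ∀ x S K r → x * (S + K * r) ≡ S * x + K * (x * r)
    lemma = solve-∀

  Greedy⇒combination : ∀ n f → Greedy n f →
    combination b n (λ i → f (toℕ i)) ≡ suc (M n) * cost n (value n f) + M n * c * value n f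
  Greedy⇒combination n f g = trans (combination-toℕ n f)
    (cong (λ x → suc (M n) * x + M n * c * value n f) (sym (cost-value n f g)))

  *∈T′ : ∀ n k {x} → T′ b n x → T′ b n (k * x)
  *∈T′ n zero    x∈T = zero
  *∈T′ n (suc k) x∈T = add x∈T (*∈T′ n k x∈T)

  combination∈T′ : ∀ n t → T′ b n (combination b n t)
  combination∈T′ n t = sum∈T′ (suc n) λ i → *∈T′ n (t i) (gen (suc (toℕ i) , refl))
    where
    sum∈T′ : ∀ k {g : Vector ℕ k} → (∀ i → T′ b n (g i)) → T′ b n (sum g)
    sum∈T′ zero    g∈T = zero
    sum∈T′ (suc k) g∈T = add (g∈T zero) (sum∈T′ k λ i → g∈T (suc i))

  -- Arbitrary elements of the monoid.

  -- A sum of D generators s′ᵢ whose total repunit weight is Q.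
  record Form (n x : ℕ) : Set where
    field
      Q D    : ℕ
      eq     : x ≡ suc (M n) * D + M n * c * Q
      cost≤D : Q < rep (suc n) → cost n Q ≤ D

  rep-mono : ∀ {i j} → i ≤ j → rep i ≤ rep j
  rep-mono {j = j} z≤n = rep>0 j
  rep-mono (s≤s i≤j)   = s≤s (*-monoʳ-≤ b (rep-mono i≤j))

  -- A generator beyond `s′ b n (suc n)` has weight at least `rep (suc n)`, so the premise of
  -- `cost≤D` fails for it and for every sum containing it; otherwise `cost-rep` and `cost-+` give
  -- the bound.
  T′⇒Form : ∀ n {x} → T′ b n x → Form n x
  T′⇒Form n (gen (zero , x≡)) = record
    { Q = 0 ; D = 1
    ; eq = trans (trans x≡ (s′-zero n)) (lemma (suc (M n)) (M n * c))
    ; cost≤D = λ _ → ≤-trans (≤-reflexive (cost-0 n)) z≤n }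
    where
    lemma : ∀ S K → S ≡ S * 1 + K * 0
    lemma = solve-∀
  T′⇒Form n (gen (suc i , x≡)) = record
    { Q = rep i ; D = 1
    ; eq = trans (trans x≡ (s′-suc n i)) (cong (_+ M n * c * rep i) (sym (*-identityʳ (suc (M n)))))
    ; cost≤D = λ ri<rn → cost-rep n i (≮⇒≥ λ n<i → <⇒≱ ri<rn (rep-mono n<i)) }
  T′⇒Form n zero = record
    { Q = 0 ; D = 0
    ; eq = lemma (suc (M n)) (M n * c)
    ; cost≤D = λ _ → ≤-reflexive (cost-0 n) }
    where
    lemma : ∀ S K → 0 ≡ S * 0 + K * 0
    lemma = solve-∀
  T′⇒Form n (add x∈T y∈T) with T′⇒Form n x∈T | T′⇒Form n y∈T
  ... | F | G = record
    { Q = F.Q + G.Q ; D = F.D + G.D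
    ; eq = trans (cong₂ _+_ F.eq G.eq) (lemma (suc (M n)) (M n * c) F.D F.Q G.D G.Q)
    ; cost≤D = λ Q< → ≤-trans (cost-+ n F.Q G.Q)
        (+-mono-≤ (F.cost≤D (≤-<-trans (m≤m+n F.Q G.Q) Q<)) (G.cost≤D (≤-<-trans (m≤n+m G.Q F.Q) Q<))) }
    where
    module F = Form F
    module G = Form G
    lemma : ∀ S K d q e p → S * d + K * q + (S * e + K * p) ≡ S * (d + e) + K * (q + p)
    lemma = solve-∀

  -- If Q ≥ S = suc (M n), the right-hand side is at least M n, which bounds any residue.
  cost-residue≤ : ∀ n {x} → 1 ≤ c → suc (M n) ≤ rep (suc n) → (F : Form n x) → let open Form F in
    cost n (Q % suc (M n)) ≤ D + M n * c * (Q / suc (M n))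
  cost-residue≤ n c≥1 S≤rep F = go (Q / S) (m≡m%n+[m/n]*n Q S)
    where
    open Form F
    open ≤-Reasoning
    S = suc (M n)
    q = Q % S
    go : ∀ m → Q ≡ q + m * S → cost n q ≤ D + M n * c * m
    -- Here `Q` is already reduced, and `S ≤ rep (suc n)` makes `cost≤D` applicable.
    go zero Q≡q = begin
      cost n q   ≡⟨ cong (cost n) Q≡q′ ⟨
      cost n Q   ≤⟨ cost≤D (≤-trans (subst (_< S) (sym Q≡q′) (m%n<n Q S)) S≤rep) ⟩
      D          ≤⟨ m≤m+n D _ ⟩
      D + M n * c * 0  ∎
      where
      Q≡q′ : Q ≡ q
      Q≡q′ = trans Q≡q (+-identityʳ q)
    go (suc m) _ = begin
      cost n q             ≤⟨ cost≤ n q ⟩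
      q                    ≤⟨ s≤s⁻¹ (m%n<n Q S) ⟩
      M n                  ≡⟨ trans (*-identityʳ (M n * 1)) (*-identityʳ (M n)) ⟨
      M n * 1 * 1          ≤⟨ *-mono-≤ (*-monoʳ-≤ (M n) c≥1) (s≤s z≤n) ⟩
      M n * c * suc m      ≤⟨ m≤n+m _ D ⟩
      D + M n * c * suc m  ∎

  -- Lowering the weight by a multiple `m * S` is compensated by `M n * c * m` further copies of
  -- `S`. The weight that remains is a residue, as in the greedy representatives.
  Form-eq : ∀ n {x} (F : Form n x) → let open Form F in
    x ≡ suc (M n) * (D + M n * c * (Q / suc (M n))) + M n * c * (Q % suc (M n))
  Form-eq n F = trans eq (trans (cong (λ y → S * D + M n * c * y) (m≡m%n+[m/n]*n Q S)) (lemma S (M n * c) D (Q % S) (Q / S)))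
    where
    open Form F
    S = suc (M n)
    lemma : ∀ S K D q m → S * D + K * (q + m * S) ≡ S * (D + K * m) + K * q
    lemma = solve-∀

  -- Invertibility modulo the multiplicity.

  -- Modulo c we have b ≡ 1, hence suc (M n) ≡ 3.
  coprime-mult : b % 3 ≢ 1 → ∀ k → Coprime (mult k) c
  coprime-mult b%3≢1 k {d} (d∣S , d∣c) = divisor-of-3 d d∣3 d∣c
    where
    d∣3 : d ∣ 3
    d∣3 = ∣m+n∣m⇒∣n (subst (d ∣_) (trans (+-comm 3 _) (cong (_+ 3) (sym (*-distribˡ-+ c (rep k) (rep (suc k)))))) d∣S)
                     (∣m⇒∣m*n (rep k + rep (suc k)) d∣c)
    divisor-of-3 : ∀ d → d ∣ 3 → d ∣ c → d ≡ 1
    divisor-of-3 0 0∣3 _ = contradiction (0∣⇒≡0 0∣3) λ ()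
    divisor-of-3 1 _ _ = refl
    divisor-of-3 2 (divides 0 ()) _
    divisor-of-3 2 (divides 1 ()) _
    divisor-of-3 2 (divides (suc (suc _)) ()) _
    -- `3 ∣ c` would put `b = suc c` in the excluded class 1 modulo 3.
    divisor-of-3 3 _ (divides e c≡e*3) = contradiction (trans (cong (λ x → suc x % 3) c≡e*3) ([m+kn]%n≡m%n 1 e 3)) b%3≢1
    divisor-of-3 (suc (suc (suc (suc d)))) d∣3 _ = contradiction d∣3 (>⇒∤ (s≤s (s≤s (s≤s (s≤s z≤n)))))

-- For `z = y - x`, cancelling gives `S ∣ M * c * z`. Adding `c * z` yields `S * (c * z)`, so
-- `S ∣ c * z`; coprimality yields `S ∣ z`, and `z < S` leaves only 0.
residue-unique-≤ : ∀ M c {A B x y} → Coprime (suc M) c → suc M * A + M * c * x ≡ suc M * B + M * c * y →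
  x ≤ y → y < suc M → x ≡ y
residue-unique-≤ M c {A} {B} {x} coprime eq x≤y y<S with m≤n⇒∃[o]m+o≡n x≤y
... | z , refl = sym (trans (cong (x +_) (z≡0 z S∣z (≤-<-trans (m≤n+m z x) y<S))) (+-identityʳ x))
  where
  S = suc M
  lemma₁ : ∀ s K B x z → s * B + K * (x + z) ≡ s * B + K * z + K * x
  lemma₁ = solve-∀
  lemma₂ : ∀ M c z → suc M * (c * z) ≡ M * c * z + c * z
  lemma₂ = solve-∀
  S∣Kz : S ∣ M * c * z
  S∣Kz = ∣m+n∣m⇒∣n (subst (S ∣_) (+-cancelʳ-≡ (M * c * x) _ _ (trans eq (lemma₁ S (M * c) B x z))) (m∣m*n A)) (m∣m*n B)
  S∣z : S ∣ z
  S∣z = coprime-divisor coprime (∣m+n∣m⇒∣n (subst (S ∣_) (lemma₂ M c z) (m∣m*n (c * z))) S∣Kz)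
  z≡0 : ∀ z → S ∣ z → z < S → z ≡ 0
  z≡0 zero    _   _   = refl
  z≡0 (suc z) S∣z z<S = contradiction S∣z (>⇒∤ z<S)

residue-unique : ∀ M c {A B x y} → Coprime (suc M) c → suc M * A + M * c * x ≡ suc M * B + M * c * y →
  x < suc M → y < suc M → x ≡ y
residue-unique M c {x = x} {y} coprime eq x<S y<S with ≤-total x y
... | inj₁ x≤y = residue-unique-≤ M c coprime eq x≤y y<S
... | inj₂ y≤x = sym (residue-unique-≤ M c coprime (sym eq) y≤x x<S)

-- Tuples as digit functions.

-- Passes from tuples to digit functions, so that the inductions on places run over ℕ rather than
-- `Fin`.
extend : ∀ {k} → Vector ℕ k → ℕ → ℕ
extend {zero}  t i       = 0
extend {suc k} t zero    = t zero
extend {suc k} t (suc i) = extend (λ j → t (suc j)) i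

extend-toℕ : ∀ {k} (t : Vector ℕ k) i → extend t (toℕ i) ≡ t i
extend-toℕ t zero    = refl
extend-toℕ t (suc i) = extend-toℕ (λ j → t (suc j)) i

toℕ-posₙ : ∀ m → toℕ (posₙ (suc m)) ≡ m
toℕ-posₙ m = trans (toℕ-inject₁ (fromℕ m)) (toℕ-fromℕ m)

toℕ-posₙ₊₁ : ∀ n → toℕ (posₙ₊₁ n) ≡ n
toℕ-posₙ₊₁ = toℕ-fromℕ

module _ {c : ℕ} (c≥1 : 1 ≤ c) (l : ℕ) where

  open Repunit c

  private
    n : ℕ
    n = suc (suc l)

  R′⇒Greedy : ∀ {t} → R′ b n t → Greedy n (extend t) × value n (extend t) < mult (suc l)
  R′⇒Greedy {t} R = greedy , value<mult c≥1 l f greedy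
      (subst (_≤ c) (sym top) cond-ii)
      (λ u≡c → subst (_≤ c) (sym second) (cond-iii₁ (trans (sym top) u≡c)))
      (λ v≡c u≡c → let t₁≤2 , rest = cond-iii₂ (trans (sym second) v≡c) (trans (sym top) u≡c) in
        t₁≤2 , λ i i<l → let i≤n = m≤n⇒m≤1+n (m≤n⇒m≤1+n i<l) in
          trans (digit i≤n) (rest (index i≤n)
            -- A place from 1 to `l` is neither the first nor one of the two leading places.
            (λ p → 0≢1+n (trans (sym (cong toℕ p)) (toℕ-index i≤n)))
            (λ p → <⇒≢ (s≤s i<l) (trans (sym (toℕ-index i≤n)) (trans (cong toℕ p) (toℕ-posₙ (suc l)))))
            (λ p → <⇒≢ (s≤s (m≤n⇒m≤1+n i<l)) (trans (sym (toℕ-index i≤n)) (trans (cong toℕ p) (toℕ-posₙ₊₁ n))))))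
    where
    open R′ R
    f : ℕ → ℕ
    f = extend t
    index : ∀ {i} → i ≤ n → Fin (suc n)
    index i≤n = fromℕ< (s≤s i≤n)
    toℕ-index : ∀ {i} (i≤n : i ≤ n) → toℕ (index i≤n) ≡ i
    toℕ-index i≤n = toℕ-fromℕ< (s≤s i≤n)
    digit : ∀ {i} (i≤n : i ≤ n) → f i ≡ t (index i≤n)
    digit i≤n = trans (cong f (sym (toℕ-index i≤n))) (extend-toℕ t (index i≤n))
    top : f n ≡ t (posₙ₊₁ n)
    top = trans (cong f (sym (toℕ-posₙ₊₁ n))) (extend-toℕ t (posₙ₊₁ n))
    second : f (suc l) ≡ t (posₙ n)
    second = trans (cong f (sym (toℕ-posₙ (suc l)))) (extend-toℕ t (posₙ n))
    greedy : Greedy n f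
    greedy = digits⇒Greedy n f
      (λ i i≤n → subst (_≤ b) (sym (digit i≤n)) (entries≤b (index i≤n)))
      (λ i i≤n f≡b j j<i → let j≤n = ≤-trans (<⇒≤ j<i) i≤n in
        trans (digit j≤n) (cond-i (index i≤n) (trans (sym (digit i≤n)) f≡b) (index j≤n)
          (subst₂ _<_ (sym (toℕ-index j≤n)) (sym (toℕ-index i≤n)) j<i)))

  Greedy⇒R′ : ∀ f → Greedy n f → value n f < mult (suc l) → R′ b n (λ i → f (toℕ i))
  Greedy⇒R′ f g v<m = record
    { entries≤b = λ i → Greedy⇒≤b f g (toℕ i) (toℕ≤n i)
    ; cond-i    = λ i f≡b j j<i → Greedy⇒lower f g (toℕ i) (toℕ≤n i) f≡b (toℕ j) j<i
    ; cond-ii   = subst (_≤ c) (sym top) (top≤c c≥1 l f v<m)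
    ; cond-iii₁ = λ u≡c → subst (_≤ c) (sym second) (second≤c c≥1 l f v<m (trans (sym top) u≡c))
    ; cond-iii₂ = λ v≡c u≡c → let v≡c′ = trans (sym second) v≡c; u≡c′ = trans (sym top) u≡c in
        first≤2 c≥1 l f v<m v≡c′ u≡c′ ,
        λ { zero    i≢0 _ _ → contradiction refl i≢0
          ; (suc i) _ i≢n i≢n+1 → middle≡0 c≥1 l f v<m v≡c′ u≡c′ (toℕ i)
              -- From a place at most `n`, excluding `n` and then `suc l` leaves one at most `l`.
              (s≤s⁻¹ (≤∧≢⇒< (s≤s⁻¹ (≤∧≢⇒< (toℕ≤n (suc i))
                (λ p → i≢n+1 (toℕ-injective (trans p (sym (toℕ-posₙ₊₁ n)))))))
                (λ p → i≢n (toℕ-injective (trans p (sym (toℕ-posₙ (suc l)))))))) }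
    }
    where
    toℕ≤n : ∀ (i : Fin (suc n)) → toℕ i ≤ n
    toℕ≤n i = s≤s⁻¹ (toℕ<n i)
    top : f (toℕ (posₙ₊₁ n)) ≡ f n
    top = cong f (toℕ-posₙ₊₁ n)
    second : f (toℕ (posₙ n)) ≡ f (suc l)
    second = cong f (toℕ-posₙ (suc l))

  -- The two inclusions.

  private
    S : ℕ
    S = suc (M n)

    S≤rep : S ≤ rep (suc n)
    S≤rep = m≤n⇒m≤1+n (subst (_≤ b * rep n) (sym (suc-M (suc l))) (mult≤ c≥1 l))

  -- The residue of the weight of `x` has greedy digits whose combination differs from `x` by `e`
  -- copies of `S`. If `e` were positive, `x - S` would still lie in the monoid, so `e` is 0 and `x`
  -- is that combination.
  Ap⇒R′-sums : ∀ {x} → Ap (T′ b n) S x → R′-sums b n x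
  Ap⇒R′-sums {x} (x∈T , minimal)
    with F ← T′⇒Form n x∈T
    with f , g , value≡q ← greedy-digits n (Form.Q F % S) (≤-trans (m%n<n (Form.Q F) S) S≤rep)
    with e , cost+e≡ ← m≤n⇒∃[o]m+o≡n (cost-residue≤ n c≥1 S≤rep F)
    = finish e cost+e≡
    where
    open Form F
    q = Q % S
    K = M n * c
    t : Vector ℕ (suc n)
    t i = f (toℕ i)
    t≡ : combination b n t ≡ S * cost n q + K * q
    t≡ = trans (Greedy⇒combination n f g) (cong (λ v → S * cost n v + K * v) value≡q)
    lemma : ∀ S e d K q → S * (d + e) + K * q ≡ e * S + (S * d + K * q)
    lemma = solve-∀
    x≡ : ∀ e → cost n q + e ≡ D + K * (Q / S) → x ≡ e * S + combination b n t
    x≡ e d+e≡ = trans (Form-eq n F) (trans (cong (λ y → S * y + K * q) (sym d+e≡))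
      (trans (lemma S e (cost n q) K q) (cong (e * S +_) (sym t≡))))
    S∈T : T′ b n S
    S∈T = subst (T′ b n) (s′-zero n) (gen (0 , refl))
    finish : ∀ e → cost n q + e ≡ D + K * (Q / S) → R′-sums b n x
    finish zero    d≡   = t , Greedy⇒R′ f g (subst₂ _<_ (sym value≡q) (suc-M (suc l)) (m%n<n Q S)) , x≡ 0 d≡
    finish (suc e) d+e≡ = contradiction
      (trans (+-comm _ S) (trans (sym (+-assoc S (e * S) _)) (sym (x≡ (suc e) d+e≡))))
      (minimal (e * S + combination b n t) (add (*∈T′ n e S∈T) (combination∈T′ n t)))

  -- If `u + S = x` with `u` in the monoid, uniqueness of residues gives `u` and `x` the same
  -- reduced weight `q`. Then `u` has one copy of `S` fewer than `cost n q`, whereas `cost-residue≤`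
  -- demands at least `cost n q`.
  R′-sums⇒Ap : b % 3 ≢ 1 → ∀ {x} → R′-sums b n x → Ap (T′ b n) S x
  R′-sums⇒Ap b%3≢1 {x} (t , R , x≡) = subst (T′ b n) (sym x≡) (combination∈T′ n t) , minimal
    where
    K = M n * c
    f : ℕ → ℕ
    f = extend t
    q = value n f
    g : Greedy n f
    g = proj₁ (R′⇒Greedy R)
    q<S : q < S
    q<S = subst (q <_) (sym (suc-M (suc l))) (proj₂ (R′⇒Greedy R))
    x≡′ : x ≡ S * cost n q + K * q
    x≡′ = trans x≡ (trans
      (sum-cong-≗ (λ i → cong (_* s′ b n (suc (toℕ i))) (sym (extend-toℕ t i))))
      (Greedy⇒combination n f g))
    minimal : ∀ u → T′ b n u → u + S ≢ x
    minimal u u∈T u+S≡x = <-irrefl refl (≤-trans (≤-reflexive 1+N≡cost) (subst (λ y → cost n y ≤ N) residue≡q (cost-residue≤ n c≥1 S≤rep F)))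
      where
      F = T′⇒Form n u∈T
      open Form F
      N = D + K * (Q / S)
      lemma : ∀ S N r → S * suc N + r ≡ S * N + r + S
      lemma = solve-∀
      eq′ : S * suc N + K * (Q % S) ≡ S * cost n q + K * q
      eq′ = trans (lemma S N (K * (Q % S))) (trans (cong (_+ S) (sym (Form-eq n F))) (trans u+S≡x x≡′))
      residue≡q : Q % S ≡ q
      residue≡q = residue-unique (M n) c (subst (λ s → Coprime s c) (sym (suc-M (suc l))) (coprime-mult b%3≢1 (suc l))) eq′ (m%n<n Q S) q<S
      1+N≡cost : suc N ≡ cost n q
      1+N≡cost = *-cancelˡ-≡ (suc N) (cost n q) S (+-cancelʳ-≡ (K * q) _ _ (subst (λ y → S * suc N + K * y ≡ S * cost n q + K * q) residue≡q eq′))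

mainTheorem12 : (b n : ℕ) → 2 ≤ b → b % 3 ≢ 1 → 2 ≤ n → Ap (T′ b n) (s′ b n 0) ≐ R′-sums b n
mainTheorem12 (suc c) (suc (suc l)) (s≤s c≥1) b%3≢1 (s≤s (s≤s z≤n)) =
  -- `s′ b n 0` has exponent `n + 0` and a trailing 1, so it equals `suc (M n)` only
  -- propositionally.
  subst (λ s → Ap (T′ (suc c) (suc (suc l))) s ≐ R′-sums (suc c) (suc (suc l))) (sym (Repunit.s′-zero c (suc (suc l))))
    (Ap⇒R′-sums c≥1 l , R′-sums⇒Ap c≥1 l b%3≢1)
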